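{- Let $D$ be a finite oriented graph (with at least one vertex) with minimum out-degree $\delta^+(D)\le 4$. Then there is a vertex $x\in V(D)$ with $d^+_D(x)=\delta^+(D)$ such that $x$ is a strong Seymour vertex of $D$.
   Context: A digraph has no loops and no multiple arcs; $V(D)$ and $A(D)$ denote its vertex set and arc set. An oriented graph is a digraph without 2-cycles (i.e. $(u,v)$ and $(v,u)$ are never both arcs). For a vertex $v$, $N_D^+(v)=\{y:(v,y)\in A(D)\}$ is the set of out-neighbors, $d_D^+(v)=|N_D^+(v)|$ is the out-degree, and $\delta^+(D)$ is the minimum out-degree over all vertices. The second out-neighborhood of $v$ is $$N^{++}_D(v)=\{z\in V(D)\setminus (N_D^+(v)\cup\{v\}) : (v,y),(y,z)\in A(D)\text{ for some }y\in N_D^+(v)\}.$$ For disjoint vertex sets $X,Y$, a matching from $X$ to $Y$ is a set of arcs $(x_i,y_i)\in A(D)$ with $x_i\in X$, $y_i\in Y$, no two of which share an endpoint; it is a complete matching from $X$ to $Y$ if every vertex of $X$ is the tail of some arc of it (for $X=\emptyset$ the empty set is a complete matching). A vertex $x$ is a strong Seymour vertex of $D$ if there is a complete matching from $N^+_D(x)$ to $N^{++}_D(x)$. -}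

module Defs where

open import Data.Nat.Base using (ℕ; suc; _⊓_)
open import Data.Fin.Base using (Fin)
open import Data.Fin.Properties using (any?)
open import Data.Fin.Subset using (Subset; _∈_; ∣_∣; _∪_; _─_; ⁅_⁆)
open import Data.Product.Base using (∃; _×_; _,_)
open import Data.Sum.Base using (_⊎_)
open import Data.Vec.Base using (tabulate; foldr₁)
open import Level using (0ℓ)
open import Relation.Binary.Core using (Rel)
open import Relation.Binary.Definitions using (Asymmetric; Decidable; Irreflexive)
open import Relation.Binary.PropositionalEquality.Core using (_≡_; _≢_)
open import Relation.Nullary using (¬_; does; _×-dec_)
import Relation.Unary as U

-- The finite vertex set is Fin n.  Arcs form a (decidable) relation, and only
-- the truth of x ⟶ y is ever used, so there are no multiple arcs.
record Digraph (n : ℕ) : Set₁ where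
  infix 4 _⟶_ _⟶?_
  field
    _⟶_      : Rel (Fin n) 0ℓ
    _⟶?_     : Decidable _⟶_
    loopless : Irreflexive _≡_ _⟶_

IsOriented : ∀ {n} → Digraph n → Set
IsOriented D = Asymmetric (Digraph._⟶_ D)

-- The subset { x | P x }.
⟪_⟫ : ∀ {n} {P : U.Pred (Fin n) 0ℓ} → U.Decidable P → Subset n
⟪ P? ⟫ = tabulate (λ x → does (P? x))

module _ {n : ℕ} (D : Digraph n) where
  open Digraph D

  N⁺ : Fin n → Subset n
  N⁺ v = ⟪ (λ y → v ⟶? y) ⟫

  d⁺ : Fin n → ℕ
  d⁺ v = ∣ N⁺ v ∣

  N⁺⁺ : Fin n → Subset n
  N⁺⁺ v = ⟪ (λ z → any? (λ y → (v ⟶? y) ×-dec (y ⟶? z))) ⟫ ─ (N⁺ v ∪ ⁅ v ⁆)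

δ⁺ : ∀ {n} → Digraph (suc n) → ℕ
δ⁺ D = foldr₁ _⊓_ (tabulate (d⁺ D))

ShareEndpoint : ∀ {n} → Rel (Fin n × Fin n) 0ℓ
ShareEndpoint (x , y) (x′ , y′) = x ≡ x′ ⊎ x ≡ y′ ⊎ y ≡ x′ ⊎ y ≡ y′

module _ {n : ℕ} (D : Digraph n) where
  open Digraph D

  -- Intended for disjoint X and Y; N⁺ v and N⁺⁺ v are always disjoint.
  record IsMatching (X Y : Subset n) (M : U.Pred (Fin n × Fin n) 0ℓ) : Set where
    field
      arcs     : ∀ {x y} → M (x , y) → x ∈ X × y ∈ Y × x ⟶ y
      disjoint : ∀ {e f} → M e → M f → e ≢ f → ¬ ShareEndpoint e f

  record IsCompleteMatching (X Y : Subset n) (M : U.Pred (Fin n × Fin n) 0ℓ) : Set where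
    field
      isMatching : IsMatching X Y M
      covers     : ∀ {x} → x ∈ X → ∃ λ y → M (x , y)

  -- M need not be assumed decidable: `covers` picks for each x ∈ X some y with
  -- M (x , y), and by `disjoint` M consists of exactly these pairs.
  IsStrongSeymour : Fin n → Set₁
  IsStrongSeymour x = ∃ λ M → IsCompleteMatching (N⁺ D x) (N⁺⁺ D x) M

{-# OPTIONS --safe #-}
-- By Hall's theorem, if a vertex x of minimum out-degree δ is not strong Seymour
-- then some nonempty S ⊆ N⁺(x) has fewer than ∣S∣ out-neighbours in N⁺⁺(x).  Let Z
-- consist of these and of N⁺(x) ∖ S: all arcs from S end in S ∪ Z and ∣Z∣ < δ, so
-- each vertex of S has an out-neighbour in S, and if it has only one, it has
-- out-degree δ and dominates Z.  As ∣S∣ ≤ 4, there are u → v → w in S such that v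
-- and w are the only out-neighbours in S of u and v respectively.
--
-- Then u is strong Seymour.  Otherwise take S′, Z′ for u: S′ ⊆ N⁺(u) = {v} ∪ Z, and
-- v dominates Z, so S′ ∖ {v} ⊆ Z still has minimum out-degree at least 1.  Since
-- ∣Z∣ ≤ 3, it is a directed triangle equal to Z, and it dominates Z′.  Hence v ∉ Z′,
-- so v ∈ S′ and w ∈ Z′.  Thus Z dominates w, so N⁺(w) ⊆ S ∖ {w} has fewer than
-- δ elements.
module Submission where

open import Defs
open import Data.Empty using (⊥; ⊥-elim)
open import Data.Fin.Base using (Fin; zero; suc)
open import Data.Fin.Properties using (any?; _≟_)
open import Data.Fin.Subset
  using (Subset; inside; outside; Nonempty; _∈_; _∉_; _⊆_; ∣_∣; _∪_; _∩_; _─_; _-_; ⁅_⁆)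
open import Data.Fin.Subset.Properties
open import Data.List.Base using (List; []; _∷_; length)
import Data.List.Membership.Propositional as List
open import Data.List.Relation.Unary.All as All using (All; []; _∷_)
open import Data.List.Relation.Unary.AllPairs using ([]; _∷_)
open import Data.List.Relation.Unary.Any using (here; there)
open import Data.List.Relation.Unary.Unique.Propositional using (Unique)
open import Data.Nat.Base using (ℕ; zero; suc; _+_; _⊓_; _≤_; _<_; s≤s; s≤s⁻¹; z≤n)
open import Data.Nat.Properties as ℕ using (module ≤-Reasoning)
open import Data.Product.Base using (∃; ∃₂; _×_; _,_; proj₁; proj₂)
open import Data.Sum.Base using (_⊎_; inj₁; inj₂)
open import Data.Vec.Base using ([]; _∷_; here; there; foldr₁; tabulate)
open import Data.Vec.Properties using ([]=⇒lookup; lookup⇒[]=; lookup∘tabulate)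
open import Function.Base using (_∘_; case_of_)
open import Level using (0ℓ)
open import Relation.Binary.Core using (REL)
import Relation.Binary.Definitions as B
open import Relation.Binary.PropositionalEquality.Core
  using (_≡_; _≢_; refl; sym; trans; cong; subst)
open import Relation.Nullary using (¬_; yes; no; does; contradiction; _×-dec_; ¬?)
open import Relation.Nullary.Decidable using (dec-true; decidable-stable)
import Relation.Unary as U

private variable
  m n : ℕ

-- Subsets of `Fin n`: comprehension, cardinalities and pigeonhole.

module _ {P : U.Pred (Fin n) 0ℓ} (P? : U.Decidable P) where

  ∈⟪⟫⁺ : ∀ {x} → P x → x ∈ ⟪ P? ⟫
  ∈⟪⟫⁺ {x} px = lookup⇒[]= x _ (trans (lookup∘tabulate _ x) (dec-true (P? x) px))

  ∈⟪⟫⁻ : ∀ {x} → x ∈ ⟪ P? ⟫ → P x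
  ∈⟪⟫⁻ {x} x∈ with P? x | trans (sym (lookup∘tabulate (λ y → does (P? y)) x)) ([]=⇒lookup x∈)
  ... | yes px | _ = px
  ... | no  _  | ()

x∈p─q⇒x∉q : ∀ (p q : Subset n) {x} → x ∈ p ─ q → x ∉ q
x∈p─q⇒x∉q (_ ∷ p) (outside ∷ q) (there x∈) (there x∈q) = x∈p─q⇒x∉q p q x∈ x∈q
x∈p─q⇒x∉q (_ ∷ p) (inside  ∷ q) (there x∈) (there x∈q) = x∈p─q⇒x∉q p q x∈ x∈q

-- Stated with a sum to avoid truncated subtraction; the bounds on unions and differences below come
-- from this identity.
∣p─q∣+∣q∣≡∣p∪q∣ : ∀ (p q : Subset n) → ∣ p ─ q ∣ + ∣ q ∣ ≡ ∣ p ∪ q ∣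
∣p─q∣+∣q∣≡∣p∪q∣ []            []            = refl
∣p─q∣+∣q∣≡∣p∪q∣ (outside ∷ p) (outside ∷ q) = ∣p─q∣+∣q∣≡∣p∪q∣ p q
∣p─q∣+∣q∣≡∣p∪q∣ (inside  ∷ p) (outside ∷ q) = cong suc (∣p─q∣+∣q∣≡∣p∪q∣ p q)
∣p─q∣+∣q∣≡∣p∪q∣ (outside ∷ p) (inside  ∷ q) =
  trans (ℕ.+-suc _ _) (cong suc (∣p─q∣+∣q∣≡∣p∪q∣ p q))
∣p─q∣+∣q∣≡∣p∪q∣ (inside  ∷ p) (inside  ∷ q) =
  trans (ℕ.+-suc _ _) (cong suc (∣p─q∣+∣q∣≡∣p∪q∣ p q))

∣p∪q∣≤∣p∣+∣q∣ : ∀ (p q : Subset n) → ∣ p ∪ q ∣ ≤ ∣ p ∣ + ∣ q ∣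
∣p∪q∣≤∣p∣+∣q∣ p q = begin
  ∣ p ∪ q ∣          ≡⟨ ∣p─q∣+∣q∣≡∣p∪q∣ p q ⟨
  ∣ p ─ q ∣ + ∣ q ∣  ≤⟨ ℕ.+-monoˡ-≤ ∣ q ∣ (∣p─q∣≤∣p∣ p q) ⟩
  ∣ p ∣ + ∣ q ∣      ∎
  where open ≤-Reasoning

q⊆p⇒∣p─q∣+∣q∣≤∣p∣ : ∀ {p q : Subset n} → q ⊆ p → ∣ p ─ q ∣ + ∣ q ∣ ≤ ∣ p ∣
q⊆p⇒∣p─q∣+∣q∣≤∣p∣ {p = p} {q} q⊆p =
  ℕ.≤-trans (ℕ.≤-reflexive (∣p─q∣+∣q∣≡∣p∪q∣ p q)) (p⊆q⇒∣p∣≤∣q∣ p∪q⊆p)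
  where
  p∪q⊆p : p ∪ q ⊆ p
  p∪q⊆p x∈ with x∈p∪q⁻ p q x∈
  ... | inj₁ x∈p = x∈p
  ... | inj₂ x∈q = q⊆p x∈q

disjoint⇒∣p∣+∣q∣≤∣p∪q∣ : ∀ {p q : Subset n} → (∀ {x} → x ∈ p → x ∉ q) → ∣ p ∣ + ∣ q ∣ ≤ ∣ p ∪ q ∣
disjoint⇒∣p∣+∣q∣≤∣p∪q∣ {p = p} {q} p#q = begin
  ∣ p ∣ + ∣ q ∣      ≤⟨ ℕ.+-monoˡ-≤ ∣ q ∣ (p⊆q⇒∣p∣≤∣q∣ (λ x∈p → x∈p∧x∉q⇒x∈p─q x∈p (p#q x∈p))) ⟩
  ∣ p ─ q ∣ + ∣ q ∣  ≡⟨ ∣p─q∣+∣q∣≡∣p∪q∣ p q ⟩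
  ∣ p ∪ q ∣          ∎
  where open ≤-Reasoning

∣⁅x⁆∪p∣≤1+∣p∣ : ∀ x (p : Subset n) → ∣ ⁅ x ⁆ ∪ p ∣ ≤ suc ∣ p ∣
∣⁅x⁆∪p∣≤1+∣p∣ x p = ℕ.≤-trans (∣p∪q∣≤∣p∣+∣q∣ ⁅ x ⁆ p) (ℕ.≤-reflexive (cong (_+ ∣ p ∣) (∣⁅x⁆∣≡1 x)))

∣p∣≤1+∣p-x∣ : ∀ (p : Subset n) x → ∣ p ∣ ≤ suc ∣ p - x ∣
∣p∣≤1+∣p-x∣ p x = begin
  ∣ p ∣                  ≤⟨ ∣p∣≤∣p∪q∣ p ⁅ x ⁆ ⟩
  ∣ p ∪ ⁅ x ⁆ ∣          ≡⟨ ∣p─q∣+∣q∣≡∣p∪q∣ p ⁅ x ⁆ ⟨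
  ∣ p - x ∣ + ∣ ⁅ x ⁆ ∣  ≡⟨ cong (∣ p - x ∣ +_) (∣⁅x⁆∣≡1 x) ⟩
  ∣ p - x ∣ + 1          ≡⟨ ℕ.+-comm _ 1 ⟩
  suc ∣ p - x ∣          ∎
  where open ≤-Reasoning

0<∣p∣⇒nonempty : ∀ (p : Subset n) → 0 < ∣ p ∣ → Nonempty p
0<∣p∣⇒nonempty (inside  ∷ p) _   = zero , here
0<∣p∣⇒nonempty (outside ∷ p) 0<p = let x , x∈p = 0<∣p∣⇒nonempty p 0<p in suc x , there x∈p

x∈p⇒0<∣p∣ : ∀ {p : Subset n} {x} → x ∈ p → 0 < ∣ p ∣
x∈p⇒0<∣p∣ x∈p = ℕ.≤-<-trans z≤n (x∈p⇒∣p-x∣<∣p∣ x∈p)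

p⊆q∧∣q∣≤∣p∣⇒q⊆p : ∀ {p q : Subset n} → p ⊆ q → ∣ q ∣ ≤ ∣ p ∣ → q ⊆ p
p⊆q∧∣q∣≤∣p∣⇒q⊆p {p = p} p⊆q ∣q∣≤∣p∣ {x} x∈q with x ∈? p
... | yes x∈p = x∈p
... | no  x∉p = contradiction (p⊂q⇒∣p∣<∣q∣ (p⊆q , x , x∈q , x∉p)) (ℕ.≤⇒≯ ∣q∣≤∣p∣)

-- Pigeonhole, by deleting the head of the list from `p`. It turns a bound on the size of a subset
-- into a case analysis over named vertices.
unique⇒exhaustive : ∀ {p : Subset n} {xs : List (Fin n)} → Unique xs → All (_∈ p) xs →
                    ∣ p ∣ ≤ length xs → ∀ {y} → y ∈ p → y List.∈ xs
unique⇒exhaustive {xs = []} [] [] ∣p∣≤0 y∈p = contradiction (ℕ.<-≤-trans (x∈p⇒0<∣p∣ y∈p) ∣p∣≤0) λ ()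
unique⇒exhaustive {p = p} {xs = x ∷ xs} (x≢xs ∷ xs!) (x∈p ∷ xs⊆p) ∣p∣≤ {y} y∈p with y ≟ x
... | yes y≡x = here y≡x
... | no  y≢x = there (unique⇒exhaustive xs!
  (All.zipWith (λ (x≢z , z∈p) → x∈p∧x≢y⇒x∈p-y z∈p (x≢z ∘ sym)) (x≢xs , xs⊆p))
  (s≤s⁻¹ (ℕ.<-≤-trans (x∈p⇒∣p-x∣<∣p∣ x∈p) ∣p∣≤))
  (x∈p∧x≢y⇒x∈p-y y∈p y≢x))

-- The minimum of a finite family.

foldr₁-⊓-attained : ∀ (f : Fin (suc n) → ℕ) → ∃ λ x → f x ≡ foldr₁ _⊓_ (tabulate f)
foldr₁-⊓-attained {zero}  f = zero , refl
foldr₁-⊓-attained {suc n} f with ℕ.⊓-sel (f zero) (foldr₁ _⊓_ (tabulate (f ∘ suc)))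
... | inj₁ eq = zero , sym eq
... | inj₂ eq = let x , fx≡ = foldr₁-⊓-attained (f ∘ suc) in suc x , trans fx≡ (sym eq)

foldr₁-⊓-lower : ∀ (f : Fin (suc n) → ℕ) x → foldr₁ _⊓_ (tabulate f) ≤ f x
foldr₁-⊓-lower {zero}  f zero    = ℕ.≤-refl
foldr₁-⊓-lower {suc n} f zero    = ℕ.m⊓n≤m _ _
foldr₁-⊓-lower {suc n} f (suc x) = ℕ.≤-trans (ℕ.m⊓n≤n (f zero) _) (foldr₁-⊓-lower (f ∘ suc) x)

-- Hall's theorem.

module Hall {_~_ : REL (Fin m) (Fin n) 0ℓ} (_~?_ : B.Decidable _~_) where

  hit? : ∀ S → U.Decidable (λ y → ∃ λ x → x ∈ S × x ~ y)
  hit? S y = any? (λ x → (x ∈? S) ×-dec (x ~? y))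

  image : Subset m → Subset n
  image S = ⟪ hit? S ⟫

  ∈image⁺ : ∀ {S x y} → x ∈ S → x ~ y → y ∈ image S
  ∈image⁺ {S} {x} x∈S x~y = ∈⟪⟫⁺ (hit? S) (x , x∈S , x~y)

  ∈image⁻ : ∀ {S y} → y ∈ image S → ∃ λ x → x ∈ S × x ~ y
  ∈image⁻ {S} = ∈⟪⟫⁻ (hit? S)

  -- A relation rather than a function, so that two matchings are glued by taking their union.
  record Matching (X : Subset m) (Y : Subset n) : Set₁ where
    field
      _↦_        : REL (Fin m) (Fin n) 0ℓ
      sound      : ∀ {x y} → x ↦ y → x ∈ X × y ∈ Y × x ~ y
      functional : ∀ {x y y′} → x ↦ y → x ↦ y′ → y ≡ y′
      injective  : ∀ {x x′ y} → x ↦ y → x′ ↦ y → x ≡ x′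
      total      : ∀ {x} → x ∈ X → ∃ λ y → x ↦ y

  glue : ∀ {X X₁ X₂ Y Y₁ Y₂} → X₁ ⊆ X → X₂ ⊆ X → (∀ {x} → x ∈ X → x ∈ X₁ ⊎ x ∈ X₂) →
         Y₁ ⊆ Y → Y₂ ⊆ Y → (∀ {x} → x ∈ X₁ → x ∉ X₂) → (∀ {y} → y ∈ Y₁ → y ∉ Y₂) →
         Matching X₁ Y₁ → Matching X₂ Y₂ → Matching X Y
  glue X₁⊆X X₂⊆X cover Y₁⊆Y Y₂⊆Y X₁#X₂ Y₁#Y₂ M N = record
    { _↦_        = λ x y → x M.↦ y ⊎ x N.↦ y
    ; sound      = λ where
        (inj₁ p) → let x∈ , y∈ , x~y = M.sound p in X₁⊆X x∈ , Y₁⊆Y y∈ , x~y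
        (inj₂ p) → let x∈ , y∈ , x~y = N.sound p in X₂⊆X x∈ , Y₂⊆Y y∈ , x~y
    ; functional = λ where
        (inj₁ p) (inj₁ q) → M.functional p q
        (inj₁ p) (inj₂ q) → contradiction (proj₁ (N.sound q)) (X₁#X₂ (proj₁ (M.sound p)))
        (inj₂ p) (inj₁ q) → contradiction (proj₁ (N.sound p)) (X₁#X₂ (proj₁ (M.sound q)))
        (inj₂ p) (inj₂ q) → N.functional p q
    ; injective  = λ where
        (inj₁ p) (inj₁ q) → M.injective p q
        (inj₁ p) (inj₂ q) → contradiction (proj₁ (proj₂ (N.sound q))) (Y₁#Y₂ (proj₁ (proj₂ (M.sound p))))
        (inj₂ p) (inj₁ q) → contradiction (proj₁ (proj₂ (N.sound p))) (Y₁#Y₂ (proj₁ (proj₂ (M.sound q))))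
        (inj₂ p) (inj₂ q) → N.injective p q
    ; total      = λ x∈X → total (cover x∈X)
    }
    where
    module M = Matching M
    module N = Matching N
    total : ∀ {x} → x ∈ _ ⊎ x ∈ _ → ∃ λ y → x M.↦ y ⊎ x N.↦ y
    total (inj₁ x∈) = let y , p = M.total x∈ in y , inj₁ p
    total (inj₂ x∈) = let y , p = N.total x∈ in y , inj₂ p

  singleton : ∀ {x y} → x ~ y → Matching ⁅ x ⁆ ⁅ y ⁆
  singleton {x} {y} x~y = record
    { _↦_        = λ x′ y′ → x′ ≡ x × y′ ≡ y
    ; sound      = λ { (refl , refl) → x∈⁅x⁆ x , x∈⁅x⁆ y , x~y }
    ; functional = λ { (_ , refl) (_ , refl) → refl }
    ; injective  = λ { (refl , _) (refl , _) → refl }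
    ; total      = λ x′∈ → y , x∈⁅y⁆⇒x≡y x x′∈ , refl
    }

  HallCondition : Subset m → Subset n → Set
  HallCondition X Y = ∀ S → S ⊆ X → ∣ S ∣ ≤ ∣ image S ∩ Y ∣

  -- Under `HallCondition` the last inequality is an equality. The strict bounds make both `S` and
  -- `X ─ S` smaller than `X`, as the induction requires.
  Tight : Subset m → Subset n → Subset m → Set
  Tight X Y S = S ⊆ X × 0 < ∣ S ∣ × ∣ S ∣ < ∣ X ∣ × ∣ image S ∩ Y ∣ ≤ ∣ S ∣

  tight? : ∀ X Y → U.Decidable (Tight X Y)
  tight? X Y S = (S ⊆? X) ×-dec (0 ℕ.<? ∣ S ∣) ×-dec (∣ S ∣ ℕ.<? ∣ X ∣) ×-dec (∣ image S ∩ Y ∣ ℕ.≤? ∣ S ∣)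

  -- Apply the condition to `S′ ∪ S`: at most `∣ S ∣` of its neighbours in `Y` lie in `image S`, so
  -- at least `∣ S′ ∣` remain outside.
  restrict-tight : ∀ {X Y S} → HallCondition X Y → Tight X Y S → HallCondition (X ─ S) (Y ─ image S)
  restrict-tight {X} {Y} {S} hall (S⊆X , _ , _ , tight) S′ S′⊆ = ℕ.+-cancelʳ-≤ ∣ S ∣ _ _ (begin
    ∣ S′ ∣ + ∣ S ∣                                    ≤⟨ disjoint⇒∣p∣+∣q∣≤∣p∪q∣ (x∈p─q⇒x∉q X S ∘ S′⊆) ⟩
    ∣ S′ ∪ S ∣                                        ≤⟨ hall _ S′∪S⊆X ⟩
    ∣ image (S′ ∪ S) ∩ Y ∣                            ≤⟨ p⊆q⇒∣p∣≤∣q∣ split ⟩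
    ∣ (image S′ ∩ (Y ─ image S)) ∪ (image S ∩ Y) ∣    ≤⟨ ∣p∪q∣≤∣p∣+∣q∣ (image S′ ∩ (Y ─ image S)) (image S ∩ Y) ⟩
    ∣ image S′ ∩ (Y ─ image S) ∣ + ∣ image S ∩ Y ∣    ≤⟨ ℕ.+-monoʳ-≤ _ tight ⟩
    ∣ image S′ ∩ (Y ─ image S) ∣ + ∣ S ∣              ∎)
    where
    open ≤-Reasoning
    S′∪S⊆X : S′ ∪ S ⊆ X
    S′∪S⊆X x∈ with x∈p∪q⁻ S′ S x∈
    ... | inj₁ x∈S′ = p─q⊆p X S (S′⊆ x∈S′)
    ... | inj₂ x∈S  = S⊆X x∈S
    split : image (S′ ∪ S) ∩ Y ⊆ (image S′ ∩ (Y ─ image S)) ∪ (image S ∩ Y)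
    split {y} y∈ with x∈p∩q⁻ (image (S′ ∪ S)) Y y∈
    ... | y∈im , y∈Y with y ∈? image S
    ...   | yes y∈S = x∈p∪q⁺ (inj₂ (x∈p∩q⁺ (y∈S , y∈Y)))
    ...   | no  y∉S with ∈image⁻ y∈im
    ...     | x , x∈ , x~y with x∈p∪q⁻ S′ S x∈
    ...       | inj₁ x∈S′ = x∈p∪q⁺ (inj₁ (x∈p∩q⁺ (∈image⁺ x∈S′ x~y , x∈p∧x∉q⇒x∈p─q y∈Y y∉S)))
    ...       | inj₂ x∈S  = contradiction (∈image⁺ x∈S x~y) y∉S

  -- Without tight sets, each nonempty proper subset of `X` has a neighbour to spare, so losing `y`
  -- does no harm.
  restrict-edge : ∀ {X Y x} y → x ∈ X → HallCondition X Y → ¬ ∃ (Tight X Y) → HallCondition (X - x) (Y - y)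
  restrict-edge {X} {Y} {x} y x∈X hall ¬tight S S⊆ with 0 ℕ.<? ∣ S ∣
  ... | no  0≮S = ℕ.≤-trans (ℕ.≮⇒≥ 0≮S) z≤n
  ... | yes 0<S = s≤s⁻¹ (begin
    suc ∣ S ∣                  ≤⟨ ℕ.≰⇒> (λ tight → ¬tight (S , S⊆X , 0<S , ∣S∣<∣X∣ , tight)) ⟩
    ∣ image S ∩ Y ∣            ≤⟨ ∣p∣≤1+∣p-x∣ (image S ∩ Y) y ⟩
    suc ∣ image S ∩ Y - y ∣    ≤⟨ s≤s (p⊆q⇒∣p∣≤∣q∣ shift) ⟩
    suc ∣ image S ∩ (Y - y) ∣  ∎)
    where
    open ≤-Reasoning
    S⊆X : S ⊆ X
    S⊆X = p─q⊆p X ⁅ x ⁆ ∘ S⊆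
    ∣S∣<∣X∣ : ∣ S ∣ < ∣ X ∣
    ∣S∣<∣X∣ = ℕ.≤-<-trans (p⊆q⇒∣p∣≤∣q∣ S⊆) (x∈p⇒∣p-x∣<∣p∣ x∈X)
    shift : (image S ∩ Y) - y ⊆ image S ∩ (Y - y)
    shift z∈ with x∈p∩q⁻ (image S) Y (p─q⊆p (image S ∩ Y) ⁅ y ⁆ z∈)
    ... | z∈im , z∈Y = x∈p∩q⁺ (z∈im , x∈p∧x∉q⇒x∈p─q z∈Y (x∈p─q⇒x∉q (image S ∩ Y) ⁅ y ⁆ z∈))

  -- Halmos–Vaughan: split along a tight set if there is one; otherwise any
  -- single edge can be removed.
  hall : ∀ k X Y → ∣ X ∣ ≤ k → HallCondition X Y → Matching X Y
  hall zero X Y ∣X∣≤0 _ = record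
    { _↦_        = λ _ _ → ⊥
    ; sound      = λ ()
    ; functional = λ ()
    ; injective  = λ ()
    ; total      = λ x∈X → contradiction (ℕ.<-≤-trans (x∈p⇒0<∣p∣ x∈X) ∣X∣≤0) λ ()
    }
  hall (suc k) X Y ∣X∣≤ cond with anySubset? (tight? X Y)
  ... | yes (S , t@(S⊆X , 0<S , S<X , _)) = glue
    S⊆X (p─q⊆p X S) cover (p∩q⊆q (image S) Y) (p─q⊆p Y (image S))
    (λ x∈S x∈X─S → x∈p─q⇒x∉q X S x∈X─S x∈S)
    (λ y∈ y∈Y─ → x∈p─q⇒x∉q Y (image S) y∈Y─ (p∩q⊆p (image S) Y y∈))
    (hall k S (image S ∩ Y) (s≤s⁻¹ (ℕ.<-≤-trans S<X ∣X∣≤)) condS)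
    (hall k (X ─ S) (Y ─ image S) (s≤s⁻¹ (ℕ.<-≤-trans X─S<X ∣X∣≤)) (restrict-tight cond t))
    where
    cover : ∀ {x} → x ∈ X → x ∈ S ⊎ x ∈ X ─ S
    cover {x} x∈X with x ∈? S
    ... | yes x∈S = inj₁ x∈S
    ... | no  x∉S = inj₂ (x∈p∧x∉q⇒x∈p─q x∈X x∉S)
    condS : HallCondition S (image S ∩ Y)
    condS S′ S′⊆S = ℕ.≤-trans (cond S′ (S⊆X ∘ S′⊆S)) (p⊆q⇒∣p∣≤∣q∣ λ y∈ →
      let y∈im , y∈Y = x∈p∩q⁻ (image S′) Y y∈
          x , x∈S′ , x~y = ∈image⁻ y∈im
      in x∈p∩q⁺ (y∈im , x∈p∩q⁺ (∈image⁺ (S′⊆S x∈S′) x~y , y∈Y)))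
    X─S<X : ∣ X ─ S ∣ < ∣ X ∣
    X─S<X = let x , x∈S = 0<∣p∣⇒nonempty S 0<S in
      p∩q≢∅⇒∣p─q∣<∣p∣ X S (x , x∈p∩q⁺ (S⊆X x∈S , x∈S))
  ... | no ¬tight with nonempty? X
  -- For empty `X` the call only counts the bound down to the base case.
  ...   | no  ¬ne        = hall k X Y (ℕ.≤-trans (ℕ.≮⇒≥ (¬ne ∘ 0<∣p∣⇒nonempty X)) z≤n) cond
  ...   | yes (x , x∈X) = glue
    (λ x′∈ → subst (_∈ X) (sym (x∈⁅y⁆⇒x≡y x x′∈)) x∈X) (p─q⊆p X ⁅ x ⁆) cover
    (λ y′∈ → subst (_∈ Y) (sym (x∈⁅y⁆⇒x≡y y y′∈)) y∈Y) (p─q⊆p Y ⁅ y ⁆)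
    (λ x′∈ x′∈X-x → x∈p─q⇒x∉q X ⁅ x ⁆ x′∈X-x x′∈)
    (λ y′∈ y′∈Y-y → x∈p─q⇒x∉q Y ⁅ y ⁆ y′∈Y-y y′∈)
    (singleton x~y)
    (hall k (X - x) (Y - y) (s≤s⁻¹ (ℕ.<-≤-trans (x∈p⇒∣p-x∣<∣p∣ x∈X) ∣X∣≤)) (restrict-edge y x∈X cond ¬tight))
    where
    neighbour : ∃ λ y → y ∈ Y × x ~ y
    neighbour with 0<∣p∣⇒nonempty (image ⁅ x ⁆ ∩ Y) (ℕ.≤-trans (ℕ.≤-reflexive (sym (∣⁅x⁆∣≡1 x)))
                     (cond ⁅ x ⁆ (λ x′∈ → subst (_∈ X) (sym (x∈⁅y⁆⇒x≡y x x′∈)) x∈X)))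
    ... | y , y∈ with x∈p∩q⁻ (image ⁅ x ⁆) Y y∈
    ...   | y∈im , y∈Y with ∈image⁻ y∈im
    ...     | x′ , x′∈ , x′~y = y , y∈Y , subst (_~ y) (x∈⁅y⁆⇒x≡y x x′∈) x′~y
    y = proj₁ neighbour
    y∈Y = proj₁ (proj₂ neighbour)
    x~y = proj₂ (proj₂ neighbour)
    cover : ∀ {x′} → x′ ∈ X → x′ ∈ ⁅ x ⁆ ⊎ x′ ∈ X - x
    cover {x′} x′∈X with x′ ∈? ⁅ x ⁆
    ... | yes x′∈ = inj₁ x′∈
    ... | no  x′∉ = inj₂ (x∈p∧x∉q⇒x∈p─q x′∈X x′∉)

  -- The alternative is constructive because the finitely many subsets `S` can be searched for a
  -- violator.
  matching⊎violator : ∀ X Y → Matching X Y ⊎ ∃ λ S → S ⊆ X × ∣ image S ∩ Y ∣ < ∣ S ∣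
  matching⊎violator X Y with anySubset? (λ S → (S ⊆? X) ×-dec (∣ image S ∩ Y ∣ ℕ.<? ∣ S ∣))
  ... | yes v = inj₂ v
  ... | no ¬v = inj₁ (hall ∣ X ∣ X Y ℕ.≤-refl λ S S⊆X → ℕ.≮⇒≥ (λ lt → ¬v (S , S⊆X , lt)))

-- From Hall violators to obstructions.

module _ (D : Digraph n) (oriented : IsOriented D) where
  open Digraph D
  open Hall _⟶?_

  -- Orientedness excludes `z ≡ x`, which would give a 2-cycle through `y`.
  ∈N⁺⁺-step : ∀ {x y z} → x ⟶ y → y ⟶ z → z ∉ N⁺ D x → z ∈ N⁺⁺ D x
  ∈N⁺⁺-step {x} {y} {z} x⟶y y⟶z z∉N⁺ = x∈p∧x∉q⇒x∈p─q (∈⟪⟫⁺ (λ z → any? (λ y → (x ⟶? y) ×-dec (y ⟶? z))) (y , x⟶y , y⟶z)) λ z∈ →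
    case x∈p∪q⁻ (N⁺ D x) ⁅ x ⁆ z∈ of λ where
      (inj₁ z∈N⁺) → z∉N⁺ z∈N⁺
      (inj₂ z∈x)  → oriented x⟶y (subst (y ⟶_) (x∈⁅y⁆⇒x≡y x z∈x) y⟶z)

  ∈N⁺⁺⇒∉N⁺ : ∀ {x z} → z ∈ N⁺⁺ D x → z ∉ N⁺ D x
  ∈N⁺⁺⇒∉N⁺ {x} z∈ z∈N⁺ = x∈p─q⇒x∉q _ (N⁺ D x ∪ ⁅ x ⁆) z∈ (p⊆p∪q ⁅ x ⁆ z∈N⁺)

  matching⇒strongSeymour : ∀ {x} → Matching (N⁺ D x) (N⁺⁺ D x) → IsStrongSeymour D x
  matching⇒strongSeymour M = (λ (y , z) → y ↦ z) , record
    { isMatching = record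
      { arcs     = sound
      ; disjoint = λ where
          p q e≢f (inj₁ refl)                 → e≢f (cong (_ ,_) (functional p q))
          -- A common endpoint that is a tail of one arc and a head of the other would lie in both
          -- `N⁺` and `N⁺⁺`.
          p q _   (inj₂ (inj₁ refl))          → ∈N⁺⁺⇒∉N⁺ (proj₁ (proj₂ (sound q))) (proj₁ (sound p))
          p q _   (inj₂ (inj₂ (inj₁ refl)))   → ∈N⁺⁺⇒∉N⁺ (proj₁ (proj₂ (sound p))) (proj₁ (sound q))
          p q e≢f (inj₂ (inj₂ (inj₂ refl)))   → e≢f (cong (_, _) (injective p q))
      }
    ; covers = total
    }
    where open Matching M

  -- What the argument retains of a Hall violator `S`; its deficiency survives as the bound
  -- `∣Z∣<d⁺`.
  record Obstruction (x : Fin n) : Set where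
    field
      S Z       : Subset n
      nonempty  : Nonempty S
      S⊆N⁺      : S ⊆ N⁺ D x
      N⁺-cover  : ∀ {y} → x ⟶ y → y ∈ S ⊎ y ∈ Z
      disjoint  : ∀ {y} → y ∈ S → y ∉ Z
      closed    : ∀ {y z} → y ∈ S → y ⟶ z → z ∈ S ⊎ z ∈ Z
      ∣Z∣<d⁺    : ∣ Z ∣ < d⁺ D x

  -- Passing from `N⁺ D x` to `Z` exchanges `S` for the smaller set `T`, whence the strict bound. An
  -- arc leaving `S` ends in `N⁺ D x` or else in `T`.
  violator⇒obstruction : ∀ {x S} → S ⊆ N⁺ D x → ∣ image S ∩ N⁺⁺ D x ∣ < ∣ S ∣ → Obstruction x
  violator⇒obstruction {x} {S} S⊆N⁺ ∣T∣<∣S∣ = record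
    { S        = S
    ; Z        = Z
    ; nonempty = 0<∣p∣⇒nonempty S (ℕ.≤-<-trans z≤n ∣T∣<∣S∣)
    ; S⊆N⁺     = S⊆N⁺
    ; N⁺-cover = λ x⟶y → N⁺-cover (∈⟪⟫⁺ (x ⟶?_) x⟶y)
    ; disjoint = disjoint
    ; closed   = closed
    ; ∣Z∣<d⁺   = ∣Z∣<d⁺
    }
    where
    T Z : Subset n
    T = image S ∩ N⁺⁺ D x
    Z = (N⁺ D x ─ S) ∪ T
    N⁺-cover : ∀ {y} → y ∈ N⁺ D x → y ∈ S ⊎ y ∈ Z
    N⁺-cover {y} y∈N⁺ with y ∈? S
    ... | yes y∈S = inj₁ y∈S
    ... | no  y∉S = inj₂ (x∈p∪q⁺ (inj₁ (x∈p∧x∉q⇒x∈p─q y∈N⁺ y∉S)))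
    disjoint : ∀ {y} → y ∈ S → y ∉ Z
    disjoint y∈S y∈Z with x∈p∪q⁻ (N⁺ D x ─ S) T y∈Z
    ... | inj₁ y∈ = x∈p─q⇒x∉q (N⁺ D x) S y∈ y∈S
    ... | inj₂ y∈ = ∈N⁺⁺⇒∉N⁺ (p∩q⊆q (image S) (N⁺⁺ D x) y∈) (S⊆N⁺ y∈S)
    closed : ∀ {y z} → y ∈ S → y ⟶ z → z ∈ S ⊎ z ∈ Z
    closed {y} {z} y∈S y⟶z with z ∈? N⁺ D x
    ... | yes z∈N⁺ = N⁺-cover z∈N⁺
    ... | no  z∉N⁺ = inj₂ (x∈p∪q⁺ (inj₂ (x∈p∩q⁺
      (∈image⁺ y∈S y⟶z , ∈N⁺⁺-step (∈⟪⟫⁻ (x ⟶?_) (S⊆N⁺ y∈S)) y⟶z z∉N⁺))))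
    ∣Z∣<d⁺ : ∣ Z ∣ < d⁺ D x
    ∣Z∣<d⁺ = begin-strict
      ∣ Z ∣                    ≤⟨ ∣p∪q∣≤∣p∣+∣q∣ (N⁺ D x ─ S) T ⟩
      ∣ N⁺ D x ─ S ∣ + ∣ T ∣  <⟨ ℕ.+-monoʳ-< _ ∣T∣<∣S∣ ⟩
      ∣ N⁺ D x ─ S ∣ + ∣ S ∣  ≤⟨ q⊆p⇒∣p─q∣+∣q∣≤∣p∣ S⊆N⁺ ⟩
      d⁺ D x                   ∎
      where open ≤-Reasoning

  strongSeymour⊎obstruction : ∀ x → IsStrongSeymour D x ⊎ Obstruction x
  strongSeymour⊎obstruction x with matching⊎violator (N⁺ D x) (N⁺⁺ D x)
  ... | inj₁ M                = inj₁ (matching⇒strongSeymour M)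
  ... | inj₂ (S , S⊆ , ∣T∣<) = inj₂ (violator⇒obstruction S⊆ ∣T∣<)

  -- Unique out-neighbours inside small vertex sets.

  infix 4 _⊢_⇒_
  record _⊢_⇒_ (S : Subset n) (u v : Fin n) : Set where
    field
      v∈S  : v ∈ S
      u⟶v  : u ⟶ v
      only : ∀ {w} → w ∈ S → u ⟶ w → w ≡ v

  _HasOutNeighbours : Subset n → Set
  S HasOutNeighbours = ∀ {y} → y ∈ S → ∃ λ z → z ∈ S × y ⟶ z

  SinglePath : Subset n → Set
  SinglePath S = ∃ λ u → ∃₂ λ v w → u ∈ S × S ⊢ u ⇒ v × S ⊢ v ⇒ w

  ⟶⇒≢ : ∀ {x y} → x ⟶ y → x ≢ y
  ⟶⇒≢ x⟶y refl = loopless refl x⟶y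

  single⊎double : ∀ {S u v} → v ∈ S → u ⟶ v →
                  S ⊢ u ⇒ v ⊎ ∃ λ w → w ∈ S × u ⟶ w × v ≢ w
  single⊎double {S} {u} {v} v∈S u⟶v with any? (λ w → (w ∈? S) ×-dec (u ⟶? w) ×-dec ¬? (v ≟ w))
  ... | yes (w , w∈S , u⟶w , v≢w) = inj₂ (w , w∈S , u⟶w , v≢w)
  ... | no ¬double = inj₁ (record
    { v∈S  = v∈S
    ; u⟶v  = u⟶v
    ; only = λ {w} w∈S u⟶w → sym (decidable-stable (v ≟ w) λ v≢w → ¬double (w , w∈S , u⟶w , v≢w))
    })

  module _ {S : Subset n} (out : S HasOutNeighbours) where

    -- A path a ⟶ b ⟶ c in S already exhausts Z, so it closes up to a triangle.
    triangle : ∀ {Z} → Nonempty S → S ⊆ Z → ∣ Z ∣ ≤ 3 →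
               ∀ {y} → y ∈ Z → y ∈ S × ∃ λ z → S ⊢ y ⇒ z
    triangle {Z} (a , a∈S) S⊆Z ∣Z∣≤3 with out a∈S
    ... | b , b∈S , a⟶b with out b∈S
    ...   | c , c∈S , b⟶c = λ y∈Z → case abc y∈Z of λ where
        (here refl)                 → a∈S , b , a⇒b
        (there (here refl))         → b∈S , c , b⇒c
        (there (there (here refl))) → c∈S , a , c⇒a
      where
      abc : ∀ {y} → y ∈ Z → y List.∈ a ∷ b ∷ c ∷ []
      abc = unique⇒exhaustive
        ((⟶⇒≢ a⟶b ∷ (λ { refl → oriented a⟶b b⟶c }) ∷ []) ∷ (⟶⇒≢ b⟶c ∷ []) ∷ [] ∷ [])
        (S⊆Z a∈S ∷ S⊆Z b∈S ∷ S⊆Z c∈S ∷ []) ∣Z∣≤3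
      c⟶a : c ⟶ a
      c⟶a with out c∈S
      ... | d , d∈S , c⟶d with abc (S⊆Z d∈S)
      ...   | here refl                 = c⟶d
      ...   | there (here refl)         = ⊥-elim (oriented b⟶c c⟶d)
      ...   | there (there (here refl)) = ⊥-elim (loopless refl c⟶d)
      a⇒b : S ⊢ a ⇒ b
      a⇒b = record { v∈S = b∈S ; u⟶v = a⟶b ; only = λ w∈S a⟶w → case abc (S⊆Z w∈S) of λ where
        (here refl)                 → ⊥-elim (loopless refl a⟶w)
        (there (here refl))         → refl
        (there (there (here refl))) → ⊥-elim (oriented a⟶w c⟶a) }
      b⇒c : S ⊢ b ⇒ c
      b⇒c = record { v∈S = c∈S ; u⟶v = b⟶c ; only = λ w∈S b⟶w → case abc (S⊆Z w∈S) of λ where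
        (here refl)                 → ⊥-elim (oriented b⟶w a⟶b)
        (there (here refl))         → ⊥-elim (loopless refl b⟶w)
        (there (there (here refl))) → refl }
      c⇒a : S ⊢ c ⇒ a
      c⇒a = record { v∈S = a∈S ; u⟶v = c⟶a ; only = λ w∈S c⟶w → case abc (S⊆Z w∈S) of λ where
        (here refl)                 → refl
        (there (here refl))         → ⊥-elim (oriented c⟶w b⟶c)
        (there (there (here refl))) → ⊥-elim (loopless refl c⟶w) }

    module _ (∣S∣≤4 : ∣ S ∣ ≤ 4) where

      -- c has an out-neighbour a besides b and d, so S = {a, b, c, d} and c ⇒ a.
      -- Then either a ⟶ d and d ⇒ c, or a ⇒ b.
      fork-without-arc : ∀ {b c d} → b ∈ S → c ∈ S → d ∈ S → b ⟶ c → b ⟶ d → c ≢ d → ¬ c ⟶ d →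
                         SinglePath S
      fork-without-arc {b} {c} {d} b∈S c∈S d∈S b⟶c b⟶d c≢d c↛d with out c∈S
      ... | a , a∈S , c⟶a = path
        where
        abcd : ∀ {y} → y ∈ S → y List.∈ a ∷ b ∷ c ∷ d ∷ []
        abcd = unique⇒exhaustive
          -- `a` differs from `b` because `b ⟶ c` has no reverse arc, and from `d` because `c ⟶ d`
          -- fails.
          ( ((λ { refl → oriented b⟶c c⟶a }) ∷ (⟶⇒≢ c⟶a ∘ sym) ∷ (λ { refl → c↛d c⟶a }) ∷ [])
          ∷ (⟶⇒≢ b⟶c ∷ ⟶⇒≢ b⟶d ∷ []) ∷ (c≢d ∷ []) ∷ [] ∷ [])
          (a∈S ∷ b∈S ∷ c∈S ∷ d∈S ∷ []) ∣S∣≤4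

        c⇒a : S ⊢ c ⇒ a
        c⇒a = record { v∈S = a∈S ; u⟶v = c⟶a ; only = λ w∈S c⟶w → case abcd w∈S of λ where
          (here refl)                         → refl
          (there (here refl))                 → ⊥-elim (oriented b⟶c c⟶w)
          (there (there (here refl)))         → ⊥-elim (loopless refl c⟶w)
          (there (there (there (here refl)))) → ⊥-elim (c↛d c⟶w) }

        d⇒c : a ⟶ d → S ⊢ d ⇒ c
        d⇒c a⟶d = record { v∈S = c∈S ; u⟶v = d⟶c ; only = only }
          where
          -- Uniqueness comes first: `d` has some out-neighbour in `S`, and `only` then identifies
          -- it as `c`.
          only : ∀ {w} → w ∈ S → d ⟶ w → w ≡ c
          only w∈S d⟶w with abcd w∈S
          ... | here refl                         = ⊥-elim (oriented a⟶d d⟶w)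
          ... | there (here refl)                 = ⊥-elim (oriented b⟶d d⟶w)
          ... | there (there (here refl))         = refl
          ... | there (there (there (here refl))) = ⊥-elim (loopless refl d⟶w)
          d⟶c : d ⟶ c
          d⟶c = let w , w∈S , d⟶w = out d∈S in subst (d ⟶_) (only w∈S d⟶w) d⟶w

        a⇒b : ¬ a ⟶ d → S ⊢ a ⇒ b
        a⇒b a↛d = record { v∈S = b∈S ; u⟶v = a⟶b ; only = only }
          where
          only : ∀ {w} → w ∈ S → a ⟶ w → w ≡ b
          only w∈S a⟶w with abcd w∈S
          ... | here refl                         = ⊥-elim (loopless refl a⟶w)
          ... | there (here refl)                 = refl
          ... | there (there (here refl))         = ⊥-elim (oriented c⟶a a⟶w)
          ... | there (there (there (here refl))) = ⊥-elim (a↛d a⟶w)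
          a⟶b : a ⟶ b
          a⟶b = let w , w∈S , a⟶w = out a∈S in subst (a ⟶_) (only w∈S a⟶w) a⟶w

        path : SinglePath S
        path with a ⟶? d
        ... | yes a⟶d = d , c , a , d∈S , d⇒c a⟶d , c⇒a
        ... | no  a↛d = c , a , b , c∈S , c⇒a , a⇒b a↛d

      -- At most one of `c ⟶ d` and `d ⟶ c` holds, so `c` and `d` can be named such that the first
      -- does not dominate the second.
      fork : ∀ {b c d} → b ∈ S → c ∈ S → d ∈ S → b ⟶ c → b ⟶ d → c ≢ d → SinglePath S
      fork {b} {c} {d} b∈S c∈S d∈S b⟶c b⟶d c≢d with c ⟶? d
      ... | no  c↛d = fork-without-arc b∈S c∈S d∈S b⟶c b⟶d c≢d c↛d
      ... | yes c⟶d = fork-without-arc b∈S d∈S c∈S b⟶d b⟶c (c≢d ∘ sym) (oriented c⟶d)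

      -- Walk two steps from any vertex: either both out-neighbours are unique, or a vertex with two
      -- out-neighbours supplies a fork.
      singlePath : Nonempty S → SinglePath S
      singlePath (u , u∈S) with out u∈S
      ... | v , v∈S , u⟶v with single⊎double v∈S u⟶v
      ...   | inj₂ (_ , w∈S , u⟶w , v≢w) = fork u∈S v∈S w∈S u⟶v u⟶w v≢w
      ...   | inj₁ u⇒v with out v∈S
      ...     | w , w∈S , v⟶w with single⊎double w∈S v⟶w
      ...       | inj₁ v⇒w = u , v , w , u∈S , u⇒v , v⇒w
      ...       | inj₂ (_ , z∈S , v⟶z , w≢z) = fork v∈S w∈S z∈S v⟶w v⟶z w≢z

  -- Obstructions at vertices of minimum out-degree.

  Minimum : Fin n → Set
  Minimum x = ∀ y → d⁺ D x ≤ d⁺ D y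

  module MinimumObstruction {x} (minimum : Minimum x) (o : Obstruction x) where
    open Obstruction o public

    -- Otherwise all out-neighbours of `y` lie in `Z`, which is too small for the minimum
    -- out-degree.
    outNeighbours : S HasOutNeighbours
    outNeighbours {y} y∈S with any? (λ z → (z ∈? S) ×-dec (y ⟶? z))
    ... | yes z  = z
    ... | no ¬z = contradiction (minimum y) (ℕ.<⇒≱ (ℕ.≤-<-trans (p⊆q⇒∣p∣≤∣q∣ N⁺⊆Z) ∣Z∣<d⁺))
      where
      N⁺⊆Z : N⁺ D y ⊆ Z
      N⁺⊆Z {z} z∈N⁺ with closed y∈S (∈⟪⟫⁻ (y ⟶?_) z∈N⁺)
      ... | inj₁ z∈S = ⊥-elim (¬z (z , z∈S , ∈⟪⟫⁻ (y ⟶?_) z∈N⁺))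
      ... | inj₂ z∈Z = z∈Z

    -- d⁺ u ≤ 1 + ∣ Z ∣ ≤ d⁺ x ≤ d⁺ u forces equality throughout.
    module _ {u v} (u∈S : u ∈ S) (u⇒v : S ⊢ u ⇒ v) where
      open _⊢_⇒_ u⇒v

      ⟶⇒≡⊎∈Z : ∀ {y} → u ⟶ y → y ≡ v ⊎ y ∈ Z
      ⟶⇒≡⊎∈Z u⟶y with closed u∈S u⟶y
      ... | inj₁ y∈S = inj₁ (only y∈S u⟶y)
      ... | inj₂ y∈Z = inj₂ y∈Z

      private
        N⁺⊆ : N⁺ D u ⊆ ⁅ v ⁆ ∪ Z
        N⁺⊆ y∈N⁺ with ⟶⇒≡⊎∈Z (∈⟪⟫⁻ (u ⟶?_) y∈N⁺)
        ... | inj₁ refl = x∈p∪q⁺ (inj₁ (x∈⁅x⁆ v))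
        ... | inj₂ y∈Z  = x∈p∪q⁺ (inj₂ y∈Z)

        ∣v∪Z∣≤d⁺ : ∣ ⁅ v ⁆ ∪ Z ∣ ≤ d⁺ D x
        ∣v∪Z∣≤d⁺ = ℕ.≤-trans (∣⁅x⁆∪p∣≤1+∣p∣ v Z) ∣Z∣<d⁺

      single-d⁺ : d⁺ D u ≤ d⁺ D x
      single-d⁺ = ℕ.≤-trans (p⊆q⇒∣p∣≤∣q∣ N⁺⊆) ∣v∪Z∣≤d⁺

      single-minimum : Minimum u
      single-minimum y = ℕ.≤-trans single-d⁺ (minimum y)

      dominates : ∀ {z} → z ∈ Z → u ⟶ z
      dominates z∈Z = ∈⟪⟫⁻ (u ⟶?_)
        (p⊆q∧∣q∣≤∣p∣⇒q⊆p N⁺⊆ (ℕ.≤-trans ∣v∪Z∣≤d⁺ (minimum u)) (q⊆p∪q ⁅ v ⁆ Z z∈Z))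

  -- Two obstructions are played against each other: `v` dominates `Z`, while `Z` is shown to
  -- dominate `Z′`.
  singlePath⇒unobstructed : ∀ {x} (minimum : Minimum x) (o : Obstruction x) → d⁺ D x ≤ 4 →
    let open Obstruction o in ∀ {u v w} → u ∈ S → S ⊢ u ⇒ v → S ⊢ v ⇒ w → ¬ Obstruction u
  singlePath⇒unobstructed {x} minimum o d⁺≤4 {u} {v} {w} u∈S u⇒v v⇒w o′ = impossible
    where
    open MinimumObstruction minimum o
    -- `u` has minimum out-degree too, so the results on obstructions apply to it as well.
    module O′ = MinimumObstruction (single-minimum u∈S u⇒v) o′
    open O′ using () renaming (S to S′; Z to Z′)
    module u⇒v = _⊢_⇒_ u⇒v
    module v⇒w = _⊢_⇒_ v⇒w

    u⟶S′ : ∀ {y} → y ∈ S′ → u ⟶ y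
    u⟶S′ y∈S′ = ∈⟪⟫⁻ (u ⟶?_) (O′.S⊆N⁺ y∈S′)

    v⟶Z : ∀ {z} → z ∈ Z → v ⟶ z
    v⟶Z = dominates u⇒v.v∈S v⇒w

    T : Subset n
    T = S′ - v

    T⊆S′ : T ⊆ S′
    T⊆S′ = p─q⊆p S′ ⁅ v ⁆

    T⊆Z : T ⊆ Z
    T⊆Z y∈T with ⟶⇒≡⊎∈Z u∈S u⇒v (u⟶S′ (T⊆S′ y∈T))
    ... | inj₁ refl = ⊥-elim (x∈p─q⇒x∉q S′ ⁅ v ⁆ y∈T (x∈⁅x⁆ v))
    ... | inj₂ y∈Z  = y∈Z

    -- An arc from `Z` to `v` would reverse one of the arcs `v⟶Z`.
    T-step : ∀ {y z} → y ∈ Z → z ∈ S′ → y ⟶ z → z ∈ T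
    T-step y∈Z z∈S′ y⟶z = x∈p∧x≢y⇒x∈p-y z∈S′ λ { refl → oriented y⟶z (v⟶Z y∈Z) }

    T-outNeighbours : T HasOutNeighbours
    T-outNeighbours y∈T =
      let z , z∈S′ , y⟶z = O′.outNeighbours (T⊆S′ y∈T) in z , T-step (T⊆Z y∈T) z∈S′ y⟶z , y⟶z

    -- If the vertex at hand in `S′` is `v` itself, its out-neighbour in `S′` serves instead.
    T-nonempty : Nonempty T
    T-nonempty with O′.nonempty
    ... | y , y∈S′ with y ≟ v
    ...   | no  y≢v  = y , x∈p∧x≢y⇒x∈p-y y∈S′ y≢v
    ...   | yes refl = let z , z∈S′ , v⟶z = O′.outNeighbours y∈S′ in
      z , x∈p∧x≢y⇒x∈p-y z∈S′ (⟶⇒≢ v⟶z ∘ sym)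

    Z⟶Z′ : ∀ {y z} → y ∈ Z → z ∈ Z′ → y ⟶ z
    Z⟶Z′ y∈Z with triangle T-outNeighbours T-nonempty T⊆Z (s≤s⁻¹ (ℕ.≤-trans ∣Z∣<d⁺ d⁺≤4)) y∈Z
    -- The bound 3 is `∣ Z ∣ < d⁺ D x ≤ 4`. By `triangle`, `y` lies in `T` with a unique
    -- out-neighbour there; by `T-step` it is unique in `S′`, so `y` dominates `Z′`.
    ... | y∈T , z , y⇒z = O′.dominates (T⊆S′ y∈T) (record
      { v∈S = T⊆S′ v∈S ; u⟶v = u⟶v ; only = λ w∈S′ y⟶w → only (T-step y∈Z w∈S′ y⟶w) y⟶w })
      where open _⊢_⇒_ y⇒z

    impossible : ⊥
    impossible with O′.N⁺-cover u⇒v.u⟶v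
    -- Here `Z` would dominate `v`, while `v` dominates `Z`.
    ... | inj₂ v∈Z′ = let y , y∈T = T-nonempty in oriented (Z⟶Z′ (T⊆Z y∈T) v∈Z′) (v⟶Z (T⊆Z y∈T))
    ... | inj₁ v∈S′ with O′.closed v∈S′ v⇒w.u⟶v
    -- Membership in `S′` gives `u ⟶ w`, but `v` is the only out-neighbour of `u` in `S`.
    ...   | inj₁ w∈S′ = ⟶⇒≢ v⇒w.u⟶v (sym (u⇒v.only v⇒w.v∈S (u⟶S′ w∈S′)))
    -- Now `Z` dominates `w`, so no arc leads from `w` to `Z`; the out-neighbours of `w` lie in
    -- `S - w`, fewer than `d⁺ D x` in number.
    ...   | inj₂ w∈Z′ = ℕ.<⇒≱ (begin-strict
        d⁺ D w     ≤⟨ p⊆q⇒∣p∣≤∣q∣ N⁺w⊆ ⟩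
        ∣ S - w ∣  <⟨ x∈p⇒∣p-x∣<∣p∣ v⇒w.v∈S ⟩
        ∣ S ∣      ≤⟨ p⊆q⇒∣p∣≤∣q∣ S⊆N⁺ ⟩
        d⁺ D x     ∎) (minimum w)
      where
      open ≤-Reasoning
      N⁺w⊆ : N⁺ D w ⊆ S - w
      N⁺w⊆ y∈N⁺ with ∈⟪⟫⁻ (w ⟶?_) y∈N⁺
      ... | w⟶y with closed v⇒w.v∈S w⟶y
      ...   | inj₁ y∈S = x∈p∧x≢y⇒x∈p-y y∈S (⟶⇒≢ w⟶y ∘ sym)
      ...   | inj₂ y∈Z = ⊥-elim (oriented w⟶y (Z⟶Z′ y∈Z w∈Z′))

theorem1p4 : (n : ℕ) (D : Digraph (suc n)) → IsOriented D → δ⁺ D ≤ 4 →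
    ∃ λ x → d⁺ D x ≡ δ⁺ D × IsStrongSeymour D x
theorem1p4 n D oriented δ⁺≤4 with foldr₁-⊓-attained (d⁺ D)
... | x , d⁺≡δ⁺ with strongSeymour⊎obstruction D oriented x
...   | inj₁ seymour = x , d⁺≡δ⁺ , seymour
...   | inj₂ o = conclude (singlePath D oriented outNeighbours ∣S∣≤4 nonempty)
  where
  d⁺≤4 : d⁺ D x ≤ 4
  d⁺≤4 = ℕ.≤-trans (ℕ.≤-reflexive d⁺≡δ⁺) δ⁺≤4
  minimum : Minimum D oriented x
  minimum y = ℕ.≤-trans (ℕ.≤-reflexive d⁺≡δ⁺) (foldr₁-⊓-lower (d⁺ D) y)
  open MinimumObstruction D oriented minimum o
  ∣S∣≤4 : ∣ S ∣ ≤ 4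
  ∣S∣≤4 = ℕ.≤-trans (p⊆q⇒∣p∣≤∣q∣ S⊆N⁺) d⁺≤4
  conclude : SinglePath D oriented S → ∃ λ x → d⁺ D x ≡ δ⁺ D × IsStrongSeymour D x
  conclude (u , v , w , u∈S , u⇒v , v⇒w) with strongSeymour⊎obstruction D oriented u
  ... | inj₁ seymour = u , trans (ℕ.≤-antisym (single-d⁺ u∈S u⇒v) (minimum u)) d⁺≡δ⁺ , seymour
  ... | inj₂ o′      = ⊥-elim (singlePath⇒unobstructed D oriented minimum o d⁺≤4 u∈S u⇒v v⇒w o′)
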